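{- Let $\mathcal{L}=(L,\wedge,\vee,*,\rightarrowtail,0,1)$ be a BL-algebra, let $T_*$ be the topology on $L$ consisting of all $*$-open subsets of $L$, and let $\mathbf{T}_*$ be the topology on $L^2$ consisting of all $*$-open subsets of $L^2$. Then the mappings $*:(L^2,\mathbf{T}_*)\to(L,T_*)$ and $\rightarrowtail:(L^2,\mathbf{T}_*)\to(L,T_*)$ are continuous.
   Context: A BL-algebra is an algebra $\mathcal{L}=(L,\wedge,\vee,*,\rightarrowtail,0,1)$ of type $(2,2,2,2,0,0)$ such that: (BL1) $(L,\wedge,\vee,0,1)$ is a bounded lattice with greatest element $1$ and smallest element $0$; (BL2) $(L,*,1)$ is an Abelian monoid; (BL3) $c\le a\rightarrowtail b$ iff $c*a\le b$ for all $a,b,c\in L$; (BL4) $a\wedge b=a*(a\rightarrowtail b)$ for all $a,b\in L$; (BL5) $(a\rightarrowtail b)\vee(b\rightarrowtail a)=1$ for all $a,b\in L$. An element $a\in L$ is strongly less than $1$, written $a\ll 1$, if for every $b\in L$, $a\vee b=1$ implies $b=1$. Elements of $L^2$ are written $\mathbf{a}=(a_1,a_2)$. Define $a\leftrightarrow b=(a\rightarrowtail b)*(b\rightarrowtail a)$ for $a,b\in L$ and $\mathbf{a}\Leftrightarrow\mathbf{b}=(a_1\leftrightarrow b_1)*(a_2\leftrightarrow b_2)$ for $\mathbf{a},\mathbf{b}\in L^2$. For $r\in L$ with $r\ll 1$, $a\in L$ and $\mathbf{a}\in L^2$, the $*$-balls are $B_r(a)=\{b\in L: a\leftrightarrow b>r\}$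 and $\mathbf{B}_r(\mathbf{a})=\{\mathbf{b}\in L^2:\mathbf{a}\Leftrightarrow\mathbf{b}>r\}$ (where $x>r$ means $r\le x$ and $r\neq x$). A subset $G\subseteq L$ is $*$-open if for every $a\in G$ there exists $r\in L$ with $r\ll 1$ and $B_r(a)\subseteq G$. A subset $G\subseteq L^2$ is $*$-open if for every $\mathbf{a}\in G$ there exists $r\in L$ with $r\ll 1$ and $\mathbf{B}_r(\mathbf{a})\subseteq G$. The $*$-open subsets of $L$ (respectively $L^2$) form a topology. -}

module Defs where

open import Algebra.Core using (Op₂)
import Algebra.Structures as AlgebraStructures
open import Data.Empty.Polymorphic using (⊥)
open import Data.Product using (_×_; _,_; proj₁; proj₂; ∃-syntax)
open import Data.Product.Relation.Binary.Pointwise.NonDependent using (_×ₛ_)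
open import Data.Unit.Polymorphic using (⊤)
open import Function.Bundles using (_⇔_)
open import Level using (_⊔_) renaming (suc to lsuc)
open import Relation.Binary.Bundles using (Setoid)
open import Relation.Binary.Core using (Rel)
open import Relation.Binary.Definitions using (_Respects_)
import Relation.Binary.Construct.NaturalOrder.Left as NaturalOrder
import Relation.Binary.Construct.NonStrictToStrict as ToStrict
open import Relation.Binary.Lattice.Bundles using (JoinSemilattice)
import Relation.Binary.Lattice.Properties.JoinSemilattice as JoinSemilatticeProperties
import Relation.Binary.Lattice.Structures as LatticeStructures
open import Relation.Unary using (Pred; _⊆_; _≐_; _∩_; ⋃; _⊢_)

-- As usual, algebras and spaces are over a setoid, whose _≈_ plays the role
-- of equality.  The order is the one induced by the lattice operations:
-- x ≤ y unfolds to x ≈ x ∧ y.  Congruence of _↣_ follows from residuation,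
-- and so is not a field.

record BLAlgebra c ℓ : Set (lsuc (c ⊔ ℓ)) where
  infix  4 _≈_
  infixr 5 _↣_
  infixr 6 _∨_
  infixr 7 _∧_
  infixl 8 _*_
  field
    Carrier : Set c
    _≈_     : Rel Carrier ℓ
    _∧_     : Op₂ Carrier
    _∨_     : Op₂ Carrier
    _*_     : Op₂ Carrier
    _↣_     : Op₂ Carrier
    𝟎       : Carrier
    𝟏       : Carrier

  open NaturalOrder _≈_ _∧_ public using (_≤_)
  open LatticeStructures _≈_ _≤_ using (IsBoundedLattice)
  open AlgebraStructures _≈_ using (IsCommutativeMonoid)

  field
    isBoundedLattice      : IsBoundedLattice _∨_ _∧_ 𝟏 𝟎
    *-isCommutativeMonoid : IsCommutativeMonoid _*_ 𝟏
    residuation           : ∀ a b c → (c ≤ a ↣ b) ⇔ (c * a ≤ b)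
    divisibility          : ∀ a b → a ∧ b ≈ a * (a ↣ b)
    prelinearity          : ∀ a b → (a ↣ b) ∨ (b ↣ a) ≈ 𝟏

  setoid : Setoid c ℓ
  setoid = record
    { isEquivalence = IsBoundedLattice.isEquivalence isBoundedLattice }

-- Subsets of X at universe level p are predicates respecting equality.

record Topology {a ℓ} (X : Setoid a ℓ) p o : Set (a ⊔ ℓ ⊔ lsuc (p ⊔ o)) where
  open Setoid X
  field
    Open          : Pred Carrier p → Set o
    Open-respects : ∀ {G} → Open G → G Respects _≈_
    Open-≐        : ∀ {G H} → G ≐ H → Open G → Open H
    Open-∅        : Open (λ _ → ⊥)
    Open-U        : Open (λ _ → ⊤)
    Open-∩        : ∀ {G H} → Open G → Open H → Open (G ∩ H)
    Open-⋃        : ∀ (I : Set p) (G : I → Pred Carrier p) →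
                    (∀ i → Open (G i)) → Open (⋃ I G)

Continuous : ∀ {a ℓ b m p o q} {X : Setoid a ℓ} {Y : Setoid b m} →
             Topology X p o → Topology Y p q →
             (Setoid.Carrier X → Setoid.Carrier Y) → Set (b ⊔ lsuc p ⊔ o ⊔ q)
Continuous {p = p} {Y = Y} S T f =
  ∀ (G : Pred (Setoid.Carrier Y) p) → Topology.Open T G → Topology.Open S (f ⊢ G)

module StarTopology {c ℓ} (𝓛 : BLAlgebra c ℓ) where
  open BLAlgebra 𝓛
  open ToStrict _≈_ _≤_ public using (_<_)
  private
    open module L = LatticeStructures.IsBoundedLattice isBoundedLattice
      using (supremum)

    joinSemilattice : JoinSemilattice c ℓ ℓ
    joinSemilattice = record { isJoinSemilattice = L.isJoinSemilattice }

    open JoinSemilatticeProperties joinSemilattice using (∨-assoc)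

  L² : Setoid c ℓ
  L² = setoid ×ₛ setoid

  _≪𝟏 : Pred Carrier (c ⊔ ℓ)
  a ≪𝟏 = ∀ b → a ∨ b ≈ 𝟏 → b ≈ 𝟏

  private
    𝟎≪𝟏 : 𝟎 ≪𝟏
    𝟎≪𝟏 b 𝟎∨b≈𝟏 =
      let _ , b≤𝟎∨b , least = supremum 𝟎 b
      in L.Eq.trans (L.antisym b≤𝟎∨b (least b (L.minimum b) L.refl)) 𝟎∨b≈𝟏

    ∨-≪𝟏 : ∀ {r s} → r ≪𝟏 → s ≪𝟏 → (r ∨ s) ≪𝟏
    ∨-≪𝟏 {r} {s} r≪𝟏 s≪𝟏 b eq =
      s≪𝟏 b (r≪𝟏 (s ∨ b) (L.Eq.trans (L.Eq.sym (∨-assoc r s b)) eq))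

    ≤-<-trans : ∀ {r t y} → r ≤ t → t < y → r < y
    ≤-<-trans = ToStrict.≤-<-trans _≈_ _≤_ L.trans L.antisym L.≤-respˡ-≈

  infix 5 _↔_ _⟺_

  _↔_ : Op₂ Carrier
  a ↔ b = (a ↣ b) * (b ↣ a)

  _⟺_ : Carrier × Carrier → Carrier × Carrier → Carrier
  (a₁ , a₂) ⟺ (b₁ , b₂) = (a₁ ↔ b₁) * (a₂ ↔ b₂)

  -- The *-balls and *-open sets of a setoid X with an L-valued "nearness" e;
  -- instantiated below at L with _↔_ and at L² with _⟺_.
  module Near {x m} (X : Setoid x m)
              (e : Setoid.Carrier X → Setoid.Carrier X → Carrier) where
    open Setoid X using () renaming (Carrier to ∣X∣; _≈_ to _≈X_)

    Ball : Carrier → ∣X∣ → Pred ∣X∣ ℓ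
    Ball r a b = r < e a b

    record *-Open {p} (G : Pred ∣X∣ p) : Set (c ⊔ ℓ ⊔ x ⊔ m ⊔ p) where
      constructor *-open
      field
        respects : G Respects _≈X_
        ball     : ∀ a → G a → ∃[ r ] (r ≪𝟏 × Ball r a ⊆ G)

    topology : ∀ p → Topology X p (c ⊔ ℓ ⊔ x ⊔ m ⊔ p)
    topology p = record
      { Open          = *-Open
      ; Open-respects = *-Open.respects
      ; Open-≐        = λ { (G⊆H , H⊆G) (*-open resp ball) → *-open
          (λ x≈y Hx → G⊆H (resp x≈y (H⊆G Hx)))
          (λ a Ha → let r , r≪𝟏 , B⊆G = ball a (H⊆G Ha)
                    in r , r≪𝟏 , λ b∈B → G⊆H (B⊆G b∈B)) }
      ; Open-∅        = *-open (λ _ ()) (λ _ ())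
      ; Open-U        = *-open _ (λ _ _ → 𝟎 , 𝟎≪𝟏 , _)
      ; Open-∩        = λ { (*-open respG ballG) (*-open respH ballH) → *-open
          (λ x≈y (Gx , Hx) → respG x≈y Gx , respH x≈y Hx)
          (λ a (Ga , Ha) →
            let r , r≪𝟏 , B⊆G = ballG a Ga
                s , s≪𝟏 , B⊆H = ballH a Ha
                r≤r∨s , s≤r∨s , _ = supremum r s
            in r ∨ s , ∨-≪𝟏 r≪𝟏 s≪𝟏 ,
               λ b∈B → B⊆G (≤-<-trans r≤r∨s b∈B) , B⊆H (≤-<-trans s≤r∨s b∈B)) }
      ; Open-⋃        = λ I G G-open → *-open
          (λ x≈y (i , Gx) → i , *-Open.respects (G-open i) x≈y Gx)
          (λ a (i , Ga) → let r , r≪𝟏 , B⊆G = *-Open.ball (G-open i) a Ga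
                          in r , r≪𝟏 , λ b∈B → i , B⊆G b∈B)
      }

  T* : ∀ p → Topology setoid p (c ⊔ ℓ ⊔ p)
  T* = Near.topology setoid _↔_

  𝐓* : ∀ p → Topology L² p (c ⊔ ℓ ⊔ p)
  𝐓* = Near.topology L² _⟺_

{-# OPTIONS --safe #-}

-- Both operations are nonexpansive for ⟺ and ↔: f 𝐚 ↔ f 𝐛 lies above 𝐚 ⟺ 𝐛.
-- So f maps the *-ball of radius r around 𝐚 into the *-ball of the same
-- radius r around f 𝐚.
module Submission where

open import Defs
open import Level using (Level)
open import Data.Product using (_×_; uncurry; _,_; proj₁; proj₂)
open BLAlgebra using (_*_; _↣_)
open StarTopology using (T*; 𝐓*)

open import Algebra.Bundles using (CommutativeMonoid)
import Algebra.Properties.CommutativeSemigroup as CommutativeSemigroupProperties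
open import Function.Bundles using (Equivalence)
open import Relation.Binary.Bundles using (Poset)
import Relation.Binary.Construct.NonStrictToStrict as ToStrict
open import Relation.Binary.Lattice.Structures using (IsBoundedLattice)
import Relation.Binary.Reasoning.PartialOrder as PartialOrderReasoning

-- Read `a ↔ b` as closeness, larger meaning closer. By residuation, implications between components
-- can be multiplied (`⇒-·-≤`) or composed around a given implication (`⇒-⇒-≤`). Regrouping the four
-- factors of `𝐚 ⟺ 𝐛` into two pairs and applying such an inequality once in each direction bounds
-- `𝐚 ⟺ 𝐛` by the closeness of the images. A radius that works at the image point then works
-- unchanged for the preimage.

module BLAlgebraProperties {c ℓ} (𝓛 : BLAlgebra c ℓ) where
  open BLAlgebra 𝓛 hiding (_*_; _↣_)
  open BLAlgebra 𝓛 using () renaming (_*_ to infixl 8 _·_; _↣_ to infixr 9 _⇒_)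
  open StarTopology 𝓛 using (_<_; _↔_; _⟺_)
  open module L = IsBoundedLattice isBoundedLattice
    using (antisym; module Eq)

  poset : Poset c ℓ ℓ
  poset = record { isPartialOrder = L.isPartialOrder }

  ·-commutativeMonoid : CommutativeMonoid c ℓ
  ·-commutativeMonoid = record { isCommutativeMonoid = *-isCommutativeMonoid }

  open CommutativeMonoid ·-commutativeMonoid
    using (commutativeSemigroup)
    renaming (∙-cong to ·-cong; ∙-congʳ to ·-congʳ; assoc to ·-assoc; comm to ·-comm)
  open CommutativeSemigroupProperties commutativeSemigroup using (interchange)
  open PartialOrderReasoning poset

  curry-≤ : ∀ {x y z} → x · y ≤ z → x ≤ y ⇒ z
  curry-≤ = Equivalence.from (residuation _ _ _)

  uncurry-≤ : ∀ {x y z} → x ≤ y ⇒ z → x · y ≤ z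
  uncurry-≤ = Equivalence.to (residuation _ _ _)

  modus-ponens : ∀ x y → (x ⇒ y) · x ≤ y
  modus-ponens x y = uncurry-≤ L.refl

  -- Multiplication by `z` is a left adjoint; the unit `y ≤ z ⇒ y · z` gives monotonicity.
  ·-monoˡ-≤ : ∀ z {x y} → x ≤ y → x · z ≤ y · z
  ·-monoˡ-≤ z x≤y = uncurry-≤ (L.trans x≤y (curry-≤ L.refl))

  ·-mono-≤ : ∀ {x y u v} → x ≤ y → u ≤ v → x · u ≤ y · v
  ·-mono-≤ {x} {y} {u} {v} x≤y u≤v = begin
    x · u ≤⟨ ·-monoˡ-≤ u x≤y ⟩
    y · u ≈⟨ ·-comm y u ⟩
    u · y ≤⟨ ·-monoˡ-≤ y u≤v ⟩
    v · y ≈⟨ ·-comm v y ⟩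
    y · v ∎

  ⇒-mono-≤ : ∀ {x y u v} → y ≤ x → u ≤ v → x ⇒ u ≤ y ⇒ v
  ⇒-mono-≤ {x} {y} {u} {v} y≤x u≤v = curry-≤ (begin
    (x ⇒ u) · y ≤⟨ ·-mono-≤ L.refl y≤x ⟩
    (x ⇒ u) · x ≤⟨ modus-ponens x u ⟩
    u           ≤⟨ u≤v ⟩
    v           ∎)

  -- Needed so that preimages under `⇒` respect `≈`.
  ⇒-cong : ∀ {x y u v} → x ≈ y → u ≈ v → x ⇒ u ≈ y ⇒ v
  ⇒-cong x≈y u≈v = antisym
    (⇒-mono-≤ (L.reflexive (Eq.sym x≈y)) (L.reflexive u≈v))
    (⇒-mono-≤ (L.reflexive x≈y) (L.reflexive (Eq.sym u≈v)))

  -- After currying, each implication is paired with its own premise.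
  ⇒-·-≤ : ∀ a₁ a₂ b₁ b₂ → (a₁ ⇒ b₁) · (a₂ ⇒ b₂) ≤ (a₁ · a₂) ⇒ (b₁ · b₂)
  ⇒-·-≤ a₁ a₂ b₁ b₂ = curry-≤ (begin
    (a₁ ⇒ b₁) · (a₂ ⇒ b₂) · (a₁ · a₂)   ≈⟨ interchange _ _ _ _ ⟩
    (a₁ ⇒ b₁) · a₁ · ((a₂ ⇒ b₂) · a₂)   ≤⟨ ·-mono-≤ (modus-ponens a₁ b₁) (modus-ponens a₂ b₂) ⟩
    b₁ · b₂                             ∎)

  -- Composition along `b₁`, `a₁`, `a₂`, `b₂`: currying twice leaves three implications and the
  -- premise `b₁`, consumed by three uses of modus ponens.
  ⇒-⇒-≤ : ∀ a₁ a₂ b₁ b₂ → (b₁ ⇒ a₁) · (a₂ ⇒ b₂) ≤ (a₁ ⇒ a₂) ⇒ (b₁ ⇒ b₂)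
  ⇒-⇒-≤ a₁ a₂ b₁ b₂ = curry-≤ (curry-≤ (begin
    (b₁ ⇒ a₁) · (a₂ ⇒ b₂) · (a₁ ⇒ a₂) · b₁   ≈⟨ ·-assoc _ _ _ ⟩
    (b₁ ⇒ a₁) · (a₂ ⇒ b₂) · ((a₁ ⇒ a₂) · b₁) ≈⟨ ·-congʳ (·-comm _ _) ⟩
    (a₂ ⇒ b₂) · (b₁ ⇒ a₁) · ((a₁ ⇒ a₂) · b₁) ≈⟨ interchange _ _ _ _ ⟩
    (a₂ ⇒ b₂) · (a₁ ⇒ a₂) · ((b₁ ⇒ a₁) · b₁) ≤⟨ ·-mono-≤ L.refl (modus-ponens b₁ a₁) ⟩
    (a₂ ⇒ b₂) · (a₁ ⇒ a₂) · a₁               ≈⟨ ·-assoc _ _ _ ⟩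
    (a₂ ⇒ b₂) · ((a₁ ⇒ a₂) · a₁)             ≤⟨ ·-mono-≤ L.refl (modus-ponens a₁ a₂) ⟩
    (a₂ ⇒ b₂) · a₂                           ≤⟨ modus-ponens a₂ b₂ ⟩
    b₂                                       ∎))

  -- The analogue of 1-Lipschitz for the sum metric on pairs: the product in `⟺` plays the part of
  -- adding distances, with the order reversed.
  Nonexpansive : (Carrier × Carrier → Carrier) → Set _
  Nonexpansive f = ∀ 𝐚 𝐛 → 𝐚 ⟺ 𝐛 ≤ f 𝐚 ↔ f 𝐛

  ·-nonexpansive : Nonexpansive (uncurry _·_)
  ·-nonexpansive (a₁ , a₂) (b₁ , b₂) = begin
    (a₁ ⇒ b₁) · (b₁ ⇒ a₁) · ((a₂ ⇒ b₂) · (b₂ ⇒ a₂)) ≈⟨ interchange _ _ _ _ ⟩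
    (a₁ ⇒ b₁) · (a₂ ⇒ b₂) · ((b₁ ⇒ a₁) · (b₂ ⇒ a₂)) ≤⟨ ·-mono-≤ (⇒-·-≤ a₁ a₂ b₁ b₂) (⇒-·-≤ b₁ b₂ a₁ a₂) ⟩
    (a₁ · a₂) ↔ (b₁ · b₂)                           ∎

  ⇒-nonexpansive : Nonexpansive (uncurry _⇒_)
  ⇒-nonexpansive (a₁ , a₂) (b₁ , b₂) = begin
    -- `⇒` is antitone on the left, so the first component's two factors are swapped to pair
    -- opposite directions.
    (a₁ ⇒ b₁) · (b₁ ⇒ a₁) · ((a₂ ⇒ b₂) · (b₂ ⇒ a₂)) ≈⟨ ·-congʳ (·-comm _ _) ⟩
    (b₁ ⇒ a₁) · (a₁ ⇒ b₁) · ((a₂ ⇒ b₂) · (b₂ ⇒ a₂)) ≈⟨ interchange _ _ _ _ ⟩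
    (b₁ ⇒ a₁) · (a₂ ⇒ b₂) · ((a₁ ⇒ b₁) · (b₂ ⇒ a₂)) ≤⟨ ·-mono-≤ (⇒-⇒-≤ a₁ a₂ b₁ b₂) (⇒-⇒-≤ b₁ b₂ a₁ a₂) ⟩
    (a₁ ⇒ a₂) ↔ (b₁ ⇒ b₂)                           ∎

  <-≤-trans : ∀ {r x y} → r < x → x ≤ y → r < y
  <-≤-trans = ToStrict.<-≤-trans _≈_ _≤_ Eq.sym L.trans antisym L.≤-respʳ-≈

  nonexpansive⇒continuous : ∀ p {f : Carrier × Carrier → Carrier} →
    (∀ {x y u v} → x ≈ y → u ≈ v → f (x , u) ≈ f (y , v)) →
    Nonexpansive f → Continuous (𝐓* 𝓛 p) (T* 𝓛 p) f
  nonexpansive⇒continuous p {f} f-cong f-nonexp G G-open = record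
    { respects = λ 𝐱≈𝐲 → respects (f-cong (proj₁ 𝐱≈𝐲) (proj₂ 𝐱≈𝐲))
    ; ball     = λ 𝐚 Gf𝐚 →
        let r , r≪𝟏 , B⊆G = ball (f 𝐚) Gf𝐚
        -- The chain `r < 𝐚 ⟺ 𝐛 ≤ f 𝐚 ↔ f 𝐛` puts `f 𝐛` in the ball around `f 𝐚`.
        in r , r≪𝟏 , λ {𝐛} 𝐛∈B → B⊆G (<-≤-trans 𝐛∈B (f-nonexp 𝐚 𝐛))
    }
    where open StarTopology.Near.*-Open G-open

  ·-continuous : ∀ p → Continuous (𝐓* 𝓛 p) (T* 𝓛 p) (uncurry _·_)
  ·-continuous p = nonexpansive⇒continuous p ·-cong ·-nonexpansive

  ⇒-continuous : ∀ p → Continuous (𝐓* 𝓛 p) (T* 𝓛 p) (uncurry _⇒_)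
  ⇒-continuous p = nonexpansive⇒continuous p ⇒-cong ⇒-nonexpansive

theorem3p8 : ∀ {c ℓ : Level} (𝓛 : BLAlgebra c ℓ) (p : Level) →
    Continuous (𝐓* 𝓛 p) (T* 𝓛 p) (uncurry (_*_ 𝓛)) ×
    Continuous (𝐓* 𝓛 p) (T* 𝓛 p) (uncurry (_↣_ 𝓛))
theorem3p8 𝓛 p = ·-continuous p , ⇒-continuous p
  where open BLAlgebraProperties 𝓛
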